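{- Let $n$ and $k$ be positive integers. If $G \in \varGamma(n;k)$, then $$\Delta(G) \leq \frac{n-k^2+1}{2},$$ where $\Delta(G)$ denotes the maximum degree of $G$.
   Context: All graphs are simple, finite and undirected. The circumference $c(G)$ of a graph $G$ is the number of vertices in a longest cycle of $G$. A graph is Hamiltonian if it contains a cycle through all of its vertices. For positive integers $n$ and $k$ with $n \ge k$, $\varGamma(n;k)$ denotes the set of all graphs $G$ of order $n$ such that $c(G)=n-k$ and every induced subgraph of $G$ with $n-k$ vertices is Hamiltonian. -}

module Defs where

open import Data.Bool using (Bool; true; false; T)
open import Data.Nat using (ℕ; _≤_; _⊔_; _∸_)
open import Data.Fin using (Fin)
open import Data.Fin.Subset using (Subset; _∈_; ∣_∣)
open import Data.List using (List; []; _∷_; _++_; [_]; length; allFin; filter; map; foldr)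
open import Data.List.Relation.Unary.Linked using (Linked)
open import Data.List.Relation.Unary.Unique.Propositional using (Unique)
open import Data.Product using (Σ; ∃; _×_; _,_)
open import Relation.Binary.PropositionalEquality using (_≡_)
open import Relation.Nullary using (¬_)
open import Function using (_⇔_)

record Graph (n : ℕ) : Set where
  field
    adj   : Fin n → Fin n → Bool
    sym   : ∀ u v → adj u v ≡ adj v u
    irrefl : ∀ v → adj v v ≡ false
open Graph public

Adj : ∀ {n} → Graph n → Fin n → Fin n → Set
Adj G u v = T (adj G u v)

record Cycle {n : ℕ} (G : Graph n) : Set where
  field
    start    : Fin n
    rest     : List (Fin n)
    long     : 3 ≤ length (start ∷ rest)
    distinct : Unique (start ∷ rest)
    closed   : Linked (Adj G) ((start ∷ rest) ++ [ start ])
open Cycle public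

vertices : ∀ {n} {G : Graph n} → Cycle G → List (Fin n)
vertices C = start C ∷ rest C

len : ∀ {n} {G : Graph n} → Cycle G → ℕ
len C = length (vertices C)

Circumference≡ : ∀ {n} → Graph n → ℕ → Set
Circumference≡ G m = (Σ (Cycle G) λ C → len C ≡ m) × (∀ (C : Cycle G) → len C ≤ m)

-- The induced subgraph G[S] is Hamiltonian: there is a cycle of G whose
-- vertex set is exactly S (its edges are automatically edges of G[S]).
InducedHamiltonian : ∀ {n} → Graph n → Subset n → Set
InducedHamiltonian {n} G S =
  Σ (Cycle G) λ C → ∀ (v : Fin n) → (v ∈ S ⇔ Data.List.Membership.Propositional._∈_ v (vertices C))
  where import Data.List.Membership.Propositional

InΓ : (n k : ℕ) → Graph n → Set
InΓ n k G = Circumference≡ G (n ∸ k)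
          × (∀ (S : Subset n) → ∣ S ∣ ≡ n ∸ k → InducedHamiltonian G S)

degree : ∀ {n} → Graph n → Fin n → ℕ
degree {n} G v = length (filter (λ u → Data.Bool._≟_ (adj G v u) true) (allFin n))
  where import Data.Bool

maxDegree : ∀ {n} → Graph n → ℕ
maxDegree {n} G = foldr _⊔_ 0 (map (degree G) (allFin n))

{-# OPTIONS --safe #-}
-- Let N = n − k, and call K any set of k vertices; G − K has a cycle C through all its N vertices.
-- A path through K joining two vertices of C at distance d along C has fewer than d inner vertices,
-- since otherwise it could replace the segment of C between them and give a cycle longer than N.
--
-- This has two uses. First, an induced path z, …, v can be extended beyond z: take K to contain the
-- path without z; the successor of z on C is then adjacent to no other vertex of the path. So every v
-- is the end of an induced path y₀, …, yₖ₋₁ = v. Second, let K be this path and C = c₀, c₁, …, read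
-- cyclically. For fixed p at most one of the k + 1 adjacencies yᵢ ~ c₍p+i₎ (i < k), v ~ c₍p+k₎ holds.
-- Summing over p gives Σᵢ a(yᵢ) + a(v) ≤ N, where a counts neighbours on C. As the minimum degree is
-- at least k + 2 and the path is induced, a(v) ≥ deg v − 1, a(y₀) ≥ k + 1 and a(yᵢ) ≥ k otherwise
-- (when k ≥ 2; if k = 1 then a(v) = deg v), and the bound follows.
module Submission where

open import Defs
open import Data.Nat using (ℕ; _≤_; _*_; _+_; NonZero)
open import Data.Integer using (ℤ; +_; _-_)
open import Data.Rational using (ℚ; _/_)
import Data.Rational as ℚ

open import Data.Bool using (Bool; true; false; T)
import Data.Bool as Bool
open import Data.Bool.Properties using (T-≡)
open import Data.Empty using (⊥-elim)
open import Data.Fin using (Fin; zero; suc)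
import Data.Fin.Properties as Fin
open import Data.Fin.Subset as Subset using (Subset; outside)
import Data.Fin.Subset.Properties as Subset
import Data.Integer as ℤ
import Data.Integer.Properties as ℤ
open import Data.Integer.Tactic.RingSolver using (solve-∀)
open import Data.List
  using (List; []; _∷_; [_]; _++_; length; filter; allFin; applyUpTo; drop)
import Data.List.Membership.DecPropositional as DecMembership
open import Data.List.Membership.Propositional using (_∈_; _∉_)
open import Data.List.Membership.Propositional.Properties
  using (∈-∃++; ∈-++⁺ˡ; ∈-++⁺ʳ; ∈-++⁻; ∈-filter⁺; ∈-filter⁻; ∈-allFin; ∈-applyUpTo⁺; ∈-applyUpTo⁻)
open import Data.List.Properties
  using (length-++; length-tabulate; length-applyUpTo; length-drop; applyUpTo-∷ʳ; ++-assoc;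
         foldr-preservesᵇ)
open import Data.List.Relation.Unary.All as All using (All; []; _∷_)
import Data.List.Relation.Unary.All.Properties as All
open import Data.List.Relation.Unary.AllPairs using ([]; _∷_)
open import Data.List.Relation.Unary.Any using (here; there)
open import Data.List.Relation.Unary.Linked using (Linked; []; [-]; _∷_)
import Data.List.Relation.Unary.Linked.Properties as Linked
open import Data.List.Relation.Unary.Unique.Propositional using (Unique)
import Data.List.Relation.Unary.Unique.Propositional.Properties as Unique
open import Data.Nat using (zero; suc; _∸_; _<_; _%_; z≤n; s≤s; _⊔_; _≟_)
import Data.Nat as ℕ
open import Data.Nat.Divisibility using (_∣_; ∣m+n∣m⇒∣n; ∣⇒≤; n∣m*n)
open import Data.Nat.DivMod using (m%n<n; m<n⇒m%n≡m; m≡m%n+[m/n]*n; [m+n]%n≡m%n; [m+kn]%n≡m%n; n%n≡0)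
open import Data.Nat.Properties
open import Data.Nat.Solver using (module +-*-Solver)
open import Data.Product using (Σ; ∃; ∃₂; _×_; _,_; proj₁; proj₂)
import Data.Rational.Properties as ℚ
import Data.Rational.Unnormalised as ℚᵘ
import Data.Rational.Unnormalised.Properties as ℚᵘ
open import Data.Sum using (_⊎_; inj₁; inj₂)
import Data.Vec as Vec
open import Function using (_∘_; _⇔_; mk⇔; Equivalence)
open import Relation.Binary.PropositionalEquality as ≡
  using (_≡_; _≢_; refl; trans; cong; cong₂; subst; subst₂)
open import Relation.Nullary using (¬_; ¬?; Dec; yes; no; contradiction)

private variable
  A : Set
  n k : ℕ

-- Lists: containment, gluing and indexing.

unique-⊆⇒length≤ : {xs ys : List A} → Unique xs → (∀ {x} → x ∈ xs → x ∈ ys) → length xs ≤ length ys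
unique-⊆⇒length≤ {xs = []} _ _ = z≤n
unique-⊆⇒length≤ {xs = x ∷ xs} (x∉ ∷ u) sub with ∈-∃++ (sub (here refl))
... | as , bs , refl = begin
  suc (length xs)              ≤⟨ s≤s (unique-⊆⇒length≤ u sub′) ⟩
  suc (length (as ++ bs))      ≡⟨ cong suc (length-++ as) ⟩
  suc (length as + length bs)  ≡⟨ +-suc (length as) (length bs) ⟨
  length as + suc (length bs)  ≡⟨ length-++ as ⟨
  length (as ++ x ∷ bs)        ∎
  where
  open ≤-Reasoning
  sub′ : ∀ {y} → y ∈ xs → y ∈ as ++ bs
  sub′ y∈ with ∈-++⁻ as (sub (there y∈))
  ... | inj₁ y∈as         = ∈-++⁺ˡ y∈as
  ... | inj₂ (here refl)  = ⊥-elim (All.lookup x∉ y∈ refl)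
  ... | inj₂ (there y∈bs) = ∈-++⁺ʳ as y∈bs

linked-glue : {R : A → A → Set} (xs : List A) {y : A} {ys : List A} →
  Linked R (xs ++ [ y ]) → Linked R (y ∷ ys) → Linked R (xs ++ y ∷ ys)
linked-glue []           _         l = l
linked-glue (x ∷ [])     (r ∷ _)   l = r ∷ l
linked-glue (x ∷ z ∷ xs) (r ∷ rs)  l = r ∷ linked-glue (z ∷ xs) rs l

-- The default `d` only makes indexing total; cycles are read at positions within range.
nth : A → List A → ℕ → A
nth d []       _       = d
nth d (x ∷ xs) zero    = x
nth d (x ∷ xs) (suc i) = nth d xs i

nth-length : (d : A) (xs : List A) {y : A} {ys : List A} → nth d (xs ++ y ∷ ys) (length xs) ≡ y
nth-length d []       = refl
nth-length d (x ∷ xs) = nth-length d xs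

-- The list is read with a suffix `ys` because the vertices of a cycle will be read from its closed
-- walk, which repeats `start C` at the end.
nth-∈ : (d : A) (xs : List A) {ys : List A} {i : ℕ} → i < length xs → nth d (xs ++ ys) i ∈ xs
nth-∈ d (x ∷ xs) {i = zero}  _         = here refl
nth-∈ d (x ∷ xs) {i = suc i} (s≤s i<)  = there (nth-∈ d xs i<)

∈-nth : (d : A) {xs ys : List A} {x : A} → x ∈ xs → ∃ λ i → i < length xs × nth d (xs ++ ys) i ≡ x
∈-nth d (here refl) = 0 , s≤s z≤n , refl
∈-nth d (there x∈) with ∈-nth d x∈
... | i , i< , eq = suc i , s≤s i< , eq

nth-injective : (d : A) {xs ys : List A} {i j : ℕ} → Unique xs → i < length xs → j < length xs →
  nth d (xs ++ ys) i ≡ nth d (xs ++ ys) j → i ≡ j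
nth-injective d {x ∷ xs} {i = zero}  {zero}  _ _ _ _ = refl
nth-injective d {x ∷ xs} {i = zero}  {suc j} (x∉ ∷ _) _ (s≤s j<) eq =
  ⊥-elim (All.lookup x∉ (nth-∈ d xs j<) eq)
nth-injective d {x ∷ xs} {i = suc i} {zero}  (x∉ ∷ _) (s≤s i<) _ eq =
  ⊥-elim (All.lookup x∉ (nth-∈ d xs i<) (≡.sym eq))
nth-injective d {x ∷ xs} {i = suc i} {suc j} (_ ∷ u) (s≤s i<) (s≤s j<) eq =
  cong suc (nth-injective d u i< j< eq)

linked-nth : {R : A → A → Set} (d : A) {xs : List A} {i : ℕ} → Linked R xs → suc i < length xs →
  R (nth d xs i) (nth d xs (suc i))
linked-nth d [-] (s≤s ())
linked-nth d {i = zero}  (r ∷ _)  _        = r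
linked-nth d {i = suc i} (_ ∷ rs) (s≤s i<) = linked-nth d rs i<

-- Finite sums.

χ : Bool → ℕ
χ true  = 1
χ false = 0

∑< : ℕ → (ℕ → ℕ) → ℕ
∑< zero    f = 0
∑< (suc m) f = f 0 + ∑< m (f ∘ suc)

∑<-last : ∀ m (f : ℕ → ℕ) → ∑< (suc m) f ≡ ∑< m f + f m
∑<-last zero    f = +-identityʳ (f 0)
∑<-last (suc m) f = trans (cong (f 0 ℕ.+_) (∑<-last m (f ∘ suc))) (≡.sym (+-assoc (f 0) _ _))

-- Adding `f 0` to the left side gives `m + 1` terms, the last of which is `f m = f 0`. This rotates
-- a sum over one period of the cycle.
∑<-shift : ∀ m (f : ℕ → ℕ) → f m ≡ f 0 → ∑< m (f ∘ suc) ≡ ∑< m f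
∑<-shift m f eq = +-cancelˡ-≡ (f 0) _ _ (trans (∑<-last m f) (trans (cong (∑< m f ℕ.+_) eq) (+-comm _ (f 0))))

∑<-+ : ∀ m (f g : ℕ → ℕ) → ∑< m (λ i → f i + g i) ≡ ∑< m f + ∑< m g
∑<-+ zero    f g = refl
∑<-+ (suc m) f g = begin
  f 0 + g 0 + ∑< m (λ i → f (suc i) + g (suc i))        ≡⟨ cong (f 0 + g 0 ℕ.+_) (∑<-+ m (f ∘ suc) (g ∘ suc)) ⟩
  f 0 + g 0 + (∑< m (f ∘ suc) + ∑< m (g ∘ suc))          ≡⟨ solve 4 (λ a b c d → a :+ b :+ (c :+ d) := a :+ c :+ (b :+ d)) refl (f 0) (g 0) (∑< m (f ∘ suc)) (∑< m (g ∘ suc)) ⟩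
  f 0 + ∑< m (f ∘ suc) + (g 0 + ∑< m (g ∘ suc))          ∎
  where
  open ≡.≡-Reasoning
  open +-*-Solver

∑<-≤ : ∀ m (f : ℕ → ℕ) → (∀ i → f i ≤ 1) → ∑< m f ≤ m
∑<-≤ zero    f h = z≤n
∑<-≤ (suc m) f h = +-mono-≤ (h 0) (∑<-≤ m (f ∘ suc) (h ∘ suc))

-- Complements of vertex lists.

infixl 6 _⊝_
_⊝_ : Subset n → Fin n → Subset n
(_ Vec.∷ p) ⊝ zero  = outside Vec.∷ p
(s Vec.∷ p) ⊝ suc i = s Vec.∷ (p ⊝ i)

∣⊝∣ : {p : Subset n} {x : Fin n} → x Subset.∈ p → suc Subset.∣ p ⊝ x ∣ ≡ Subset.∣ p ∣
∣⊝∣ Vec.here = refl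
∣⊝∣ {p = true  Vec.∷ p} (Vec.there x∈) = cong suc (∣⊝∣ x∈)
∣⊝∣ {p = false Vec.∷ p} (Vec.there x∈) = ∣⊝∣ x∈

∈-⊝⁺ : {p : Subset n} {x y : Fin n} → x Subset.∈ p → x ≢ y → x Subset.∈ p ⊝ y
∈-⊝⁺ {y = zero}  Vec.here       x≢y = contradiction refl x≢y
∈-⊝⁺ {y = suc y} Vec.here       x≢y = Vec.here
∈-⊝⁺ {y = zero}  (Vec.there x∈) x≢y = Vec.there x∈
∈-⊝⁺ {y = suc y} (Vec.there x∈) x≢y = Vec.there (∈-⊝⁺ x∈ (x≢y ∘ cong suc))

∈-⊝⁻ : {p : Subset n} {x y : Fin n} → x Subset.∈ p ⊝ y → x Subset.∈ p × x ≢ y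
∈-⊝⁻ {p = _ Vec.∷ p} {y = zero}  (Vec.there x∈) = Vec.there x∈ , λ ()
∈-⊝⁻ {p = _ Vec.∷ p} {y = suc y} Vec.here       = Vec.here , λ ()
∈-⊝⁻ {p = _ Vec.∷ p} {y = suc y} (Vec.there x∈) with ∈-⊝⁻ x∈
... | x∈p , x≢y = Vec.there x∈p , λ { refl → x≢y refl }

complement : List (Fin n) → Subset n
complement []       = Subset.⊤
complement (x ∷ xs) = complement xs ⊝ x

∈-complement⁺ : {v : Fin n} (xs : List (Fin n)) → v ∉ xs → v Subset.∈ complement xs
∈-complement⁺ []       _  = Subset.∈⊤
∈-complement⁺ (x ∷ xs) v∉ = ∈-⊝⁺ (∈-complement⁺ xs (v∉ ∘ there)) (v∉ ∘ here)

∈-complement⁻ : {v : Fin n} (xs : List (Fin n)) → v Subset.∈ complement xs → v ∉ xs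
∈-complement⁻ (x ∷ xs) v∈ (here eq)    = proj₂ (∈-⊝⁻ v∈) eq
∈-complement⁻ (x ∷ xs) v∈ (there v∈xs) = ∈-complement⁻ xs (proj₁ (∈-⊝⁻ v∈)) v∈xs

∣complement∣ : {xs : List (Fin n)} → Unique xs → length xs + Subset.∣ complement xs ∣ ≡ n
∣complement∣ {n} {[]} _ = Subset.∣⊤∣≡n n
∣complement∣ {n} {x ∷ xs} (x∉ ∷ u) = begin
  suc (length xs + Subset.∣ complement xs ⊝ x ∣)  ≡⟨ +-suc (length xs) _ ⟨
  length xs + suc Subset.∣ complement xs ⊝ x ∣    ≡⟨ cong (length xs ℕ.+_) (∣⊝∣ (∈-complement⁺ xs (λ x∈ → All.lookup x∉ x∈ refl))) ⟩
  length xs + Subset.∣ complement xs ∣            ≡⟨ ∣complement∣ u ⟩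
  n                                               ∎
  where
  open ≡.≡-Reasoning

-- Enlarging a list of vertices.

_∈?_ : (v : Fin n) (xs : List (Fin n)) → Dec (v ∈ xs)
_∈?_ = DecMembership._∈?_ Fin._≟_

∃-∉ : (xs : List (Fin n)) → length xs < n → ∃ λ v → v ∉ xs
∃-∉ {n} xs xs<n with Fin.any? (λ v → ¬? (v ∈? xs))
... | yes p = p
... | no ¬p = ⊥-elim (<⇒≱ xs<n (≤-trans (≤-reflexive (≡.sym (length-tabulate {n = n} (λ i → i))))
                (unique-⊆⇒length≤ (Unique.allFin⁺ n) λ {v} _ → mem v)))
  where
  mem : ∀ v → v ∈ xs
  mem v with v ∈? xs
  ... | yes v∈ = v∈
  ... | no v∉ = ⊥-elim (¬p (v , v∉))

-- Membership in Γ(n;k) concerns deletions of exactly `k` vertices, so a shorter list must be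
-- padded, without taking in the vertex `u` that the cycle is to visit. The strict bound leaves room
-- for `u`.
extend-to : (u : Fin n) (m : ℕ) (xs : List (Fin n)) → Unique xs → u ∉ xs → m + length xs < n →
  ∃ λ ys → Unique ys × u ∉ ys × length ys ≡ m + length xs × (∀ {x} → x ∈ xs → x ∈ ys)
extend-to u zero    xs uq u∉ _ = xs , uq , u∉ , refl , λ x∈ → x∈
extend-to u (suc m) xs uq u∉ m< with extend-to u m xs uq u∉ (<⇒≤ m<)
... | ys , uys , u∉ys , len≡ , sub with ∃-∉ (u ∷ ys) (subst (λ l → suc l < _) (≡.sym len≡) m<)
...   | w , w∉ = w ∷ ys
               , All.tabulate (λ y∈ eq → w∉ (there (subst (_∈ ys) (≡.sym eq) y∈))) ∷ uys
               , (λ { (here refl) → w∉ (here refl) ; (there u∈) → u∉ys u∈ })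
               , cong suc len≡ , there ∘ sub

-- Cycles as periodic sequences.

-- Indexing by all of ℕ with period `N` removes wrap-around: the vertex `d` steps beyond `c p` is
-- `c (d + p)`. The vertex set is exactly the complement of `ks`, by `avoids` and `covers`.
record CycleAvoiding (G : Graph n) (N : ℕ) (ks : List (Fin n)) : Set where
  field
    c        : ℕ → Fin n
    periodic : ∀ p → c (N + p) ≡ c p
    step     : ∀ p → Adj G (c p) (c (suc p))
    distinct : ∀ d p → 0 < d → d < N → c (d + p) ≢ c p
    avoids   : ∀ p → c p ∉ ks
    covers   : ∀ {v} → v ∉ ks → ∃ λ p → p < N × c p ≡ v

suc-%-cases : ∀ p N .{{_ : NonZero N}} →
  (suc (p % N) < N × suc p % N ≡ suc (p % N)) ⊎ (suc (p % N) ≡ N × suc p % N ≡ 0)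
suc-%-cases p N with m≤n⇒m<n∨m≡n (m%n<n p N)
                   | trans (cong (λ q → suc q % N) (m≡m%n+[m/n]*n p N)) ([m+kn]%n≡m%n (suc (p % N)) (p ℕ./ N) N)
... | inj₁ s< | eq = inj₁ (s< , trans eq (m<n⇒m%n≡m s<))
... | inj₂ s≡ | eq = inj₂ (s≡ , trans eq (trans (cong (_% N) s≡) (n%n≡0 N)))

-- Equal residues would make `N` divide the difference `d`, which is positive and smaller than `N`.
%-distinct : ∀ {N} .{{_ : NonZero N}} d p → 0 < d → d < N → (d + p) % N ≢ p % N
%-distinct {N} d p 0<d d<N eq = <⇒≱ d<N (∣⇒≤ {{ℕ.>-nonZero 0<d}} N∣d)
  where
  open ≡.≡-Reasoning
  q = p ℕ./ N
  q′ = (d + p) ℕ./ N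
  key : q * N + d ≡ q′ * N
  key = +-cancelˡ-≡ (p % N) _ _ (begin
    p % N + (q * N + d)         ≡⟨ +-assoc (p % N) _ d ⟨
    p % N + q * N + d           ≡⟨ cong (ℕ._+ d) (m≡m%n+[m/n]*n p N) ⟨
    p + d                       ≡⟨ +-comm p d ⟩
    d + p                       ≡⟨ m≡m%n+[m/n]*n (d + p) N ⟩
    (d + p) % N + q′ * N        ≡⟨ cong (ℕ._+ q′ * N) eq ⟩
    p % N + q′ * N              ∎)
  N∣d : N ∣ d
  N∣d = ∣m+n∣m⇒∣n (subst (N ∣_) (≡.sym key) (n∣m*n q′)) (n∣m*n q)

module _ {G : Graph n} (C : Cycle G) {ks : List (Fin n)}
         (vertices⇔ : ∀ v → v ∈ vertices C ⇔ v ∉ ks) where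

  private
    N = len C
    L = vertices C ++ [ start C ]
    f = nth (start C) L

    f-step : ∀ {i} → i < N → Adj G (f i) (f (suc i))
    f-step {i} i< = linked-nth (start C) (closed C)
      (subst (suc i <_) (≡.sym (trans (length-++ (vertices C)) (+-comm N 1))) (s≤s i<))

  unroll : CycleAvoiding G N ks
  unroll = record
    { c        = λ p → f (p % N)
    ; periodic = λ p → cong f (trans (cong (_% N) (+-comm N p)) ([m+n]%n≡m%n p N))
    ; step     = step
    ; distinct = λ d p 0<d d<N eq → %-distinct d p 0<d d<N
        (nth-injective (start C) (distinct C) (m%n<n (d + p) N) (m%n<n p N) eq)
    ; avoids   = λ p → Equivalence.to (vertices⇔ _) (nth-∈ (start C) (vertices C) (m%n<n p N))
    ; covers   = covers
    }
    where
    step : ∀ p → Adj G (f (p % N)) (f (suc p % N))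
    step p with suc-%-cases p N
    ... | inj₁ (s< , eq) rewrite eq = f-step (m%n<n p N)
    -- The wrap-around edge is the last one of the closed walk: its end, at position `N`, is
    -- `start C` again.
    ... | inj₂ (s≡ , eq) rewrite eq =
      subst (λ i → Adj G (f (p % N)) i)
        (trans (cong f s≡) (nth-length (start C) (vertices C))) (f-step (m%n<n p N))
    covers : ∀ {v} → v ∉ ks → ∃ λ p → p < N × f (p % N) ≡ v
    covers v∉ with ∈-nth (start C) (Equivalence.from (vertices⇔ _) v∉)
    ... | i , i< , eq = i , i< , trans (cong f (m<n⇒m%n≡m i<)) eq

-- Cycles missing k vertices, and detours.

module InΓ-Properties {n k : ℕ} (k≤n : k ≤ n) (G : Graph n) (inΓ : InΓ n k G) where

  N : ℕ
  N = n ∸ k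

  longest : (C : Cycle G) → len C ≤ N
  longest = proj₂ (proj₁ inΓ)

  3≤N : 3 ≤ N
  3≤N with proj₁ (proj₁ inΓ)
  ... | C , len≡ = subst (3 ≤_) len≡ (long C)

  k<n : k < n
  k<n = m∸n≢0⇒n<m (λ eq → <⇒≱ (subst (2 <_) eq 3≤N) z≤n)

  adj-sym : ∀ {u v} → Adj G u v → Adj G v u
  adj-sym {u} {v} = subst T (Graph.sym G u v)

  -- The complement of `ks` has n - k vertices, hence a Hamiltonian cycle. Its length is at most `N`
  -- by the circumference, and at least `N` because `ks` and the cycle together contain every
  -- vertex.
  cycleAvoiding : {ks : List (Fin n)} → Unique ks → length ks ≡ k → CycleAvoiding G N ks
  cycleAvoiding {ks} uq len≡ with proj₂ inΓ (complement ks)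
    (trans (≡.sym (m+n∸m≡n (length ks) _)) (cong₂ _∸_ (∣complement∣ uq) len≡))
  ... | C , mem = subst (λ N → CycleAvoiding G N ks) lenC (unroll C vertices⇔)
    where
    vertices⇔ : ∀ v → v ∈ vertices C ⇔ v ∉ ks
    vertices⇔ v = mk⇔
      (λ v∈ → ∈-complement⁻ ks (Equivalence.from (mem v) v∈))
      (λ v∉ → Equivalence.to (mem v) (∈-complement⁺ ks v∉))
    all-covered : ∀ v → v ∈ ks ++ vertices C
    all-covered v with v ∈? ks
    ... | yes v∈ = ∈-++⁺ˡ v∈
    ... | no v∉ = ∈-++⁺ʳ ks (Equivalence.from (vertices⇔ v) v∉)
    lenC : len C ≡ N
    lenC = ≤-antisym (longest C) (m≤n+o⇒m∸n≤o n k (begin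
      n                           ≡⟨ length-tabulate {n = n} (λ i → i) ⟨
      length (allFin n)           ≤⟨ unique-⊆⇒length≤ (Unique.allFin⁺ n) (λ {v} _ → all-covered v) ⟩
      length (ks ++ vertices C)   ≡⟨ length-++ ks ⟩
      length ks + len C           ≡⟨ cong (ℕ._+ len C) len≡ ⟩
      k + len C                   ∎))
      where
      open ≤-Reasoning

  module _ {ks : List (Fin n)} (cyc : CycleAvoiding G N ks) where
    open CycleAvoiding cyc renaming (distinct to c-distinct)

    -- Going from `c p` through `P` to `c (d + p)` and on along the remaining `N ∸ d` steps back to
    -- `c p` would be a cycle with `1 + length P + (N ∸ d)` vertices, more than `N`.
    no-long-detour : ∀ p d (P : List (Fin n)) → 0 < d → d < N → d ≤ length P →
      Unique P → All (_∈ ks) P → ¬ Linked (Adj G) (c p ∷ P ++ [ c (d + p) ])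
    no-long-detour p d P 0<d d<N d≤P uP P⊆ks lP = <⇒≱ len> (longest C)
      where
      m = N ∸ d
      w : ℕ → Fin n
      w r = c (r + (d + p))
      W = applyUpTo w m

      w-end : w m ≡ c p
      w-end = begin
        c (m + (d + p))  ≡⟨ cong c (+-assoc m d p) ⟨
        c (m + d + p)    ≡⟨ cong (λ z → c (z + p)) (m∸n+n≡m (<⇒≤ d<N)) ⟩
        c (N + p)        ≡⟨ periodic p ⟩
        c p              ∎
        where
        open ≡.≡-Reasoning

      linked-W : Linked (Adj G) (c (d + p) ∷ applyUpTo (w ∘ suc) m)
      linked-W = Linked.applyUpTo⁺₂ w (suc m) (λ i → step (i + (d + p)))

      W-closed : c (d + p) ∷ applyUpTo (w ∘ suc) m ≡ W ++ [ c p ]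
      W-closed = trans (≡.sym (applyUpTo-∷ʳ w m)) (cong (λ z → W ++ [ z ]) w-end)

      P∌c : ∀ {q} → c q ∉ P
      P∌c c∈P = avoids _ (All.lookup P⊆ks c∈P)

      W∌start : c p ∉ W
      W∌start c∈W with ∈-applyUpTo⁻ w c∈W
      -- The vertex `w r` lies `r + d` steps beyond `c p`, and `0 < r + d < N`.
      ... | r , r<m , eq = c-distinct (r + d) p (≤-trans 0<d (m≤n+m d r))
        (subst (r + d <_) (m∸n+n≡m (<⇒≤ d<N)) (+-monoˡ-< d r<m))
        (trans (cong c (+-assoc r d p)) (≡.sym eq))

      W-distinct : ∀ {i j} → i < j → j < m → w i ≢ w j
      W-distinct {i} {j} i<j j<m eq = c-distinct (j ∸ i) (i + (d + p)) (m<n⇒0<n∸m i<j)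
        (≤-<-trans (m∸n≤m j i) (<-≤-trans j<m (m∸n≤m N d)))
        (trans (cong c (trans (≡.sym (+-assoc (j ∸ i) i (d + p))) (cong (ℕ._+ (d + p)) (m∸n+n≡m (<⇒≤ i<j)))))
               (≡.sym eq))

      len≡ : length (c p ∷ P ++ W) ≡ suc (length P + m)
      len≡ = cong suc (trans (length-++ P) (cong (length P ℕ.+_) (length-applyUpTo w m)))

      len> : N < length (c p ∷ P ++ W)
      len> = subst (N <_) (≡.sym len≡) (s≤s (subst (_≤ length P + m) (m+[n∸m]≡n (<⇒≤ d<N)) (+-monoˡ-≤ m d≤P)))

      C : Cycle G
      C = record
        { start    = c p
        ; rest     = P ++ W
        ; long     = ≤-trans 3≤N (<⇒≤ len>)
        ; distinct = All.¬Any⇒All¬ _ start∉ ∷ Unique.++⁺ uP (Unique.applyUpTo⁺₁ w m W-distinct) disjoint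
        ; closed   = subst (λ l → Linked (Adj G) (c p ∷ l)) assoc (linked-glue (c p ∷ P) lP linked-W)
        }
        where
        start∉ : c p ∉ P ++ W
        start∉ c∈ with ∈-++⁻ P c∈
        ... | inj₁ c∈P = P∌c c∈P
        ... | inj₂ c∈W = W∌start c∈W
        disjoint : ∀ {v} → ¬ (v ∈ P × v ∈ W)
        disjoint (v∈P , v∈W) with ∈-applyUpTo⁻ w v∈W
        ... | _ , _ , refl = P∌c v∈P
        assoc : P ++ c (d + p) ∷ applyUpTo (w ∘ suc) m ≡ (P ++ W) ++ [ c p ]
        assoc = trans (cong (P ++_) W-closed) (≡.sym (++-assoc P W _))

  -- Once `xs` is padded to `k` vertices without `u`, the vertex `u` is among those that the cycle
  -- covers.
  cycle-through : (u : Fin n) (xs : List (Fin n)) → Unique xs → u ∉ xs → length xs ≤ k →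
    ∃ λ ks → (∀ {x} → x ∈ xs → x ∈ ks) ×
    Σ (CycleAvoiding G N ks) λ cyc → ∃ λ p → CycleAvoiding.c cyc p ≡ u
  cycle-through u xs uq u∉ xs≤k
    with extend-to u (k ∸ length xs) xs uq u∉ (subst (_< n) (≡.sym (m∸n+n≡m xs≤k)) k<n)
  ... | ks , uks , u∉ks , len≡ , sub
    with cycleAvoiding uks (trans len≡ (m∸n+n≡m xs≤k))
  ... | cyc with CycleAvoiding.covers cyc u∉ks
  ...   | p , _ , eq = ks , sub , cyc , p , eq

  -- Neighbourhoods and minimum degree.

  neighbours : Fin n → List (Fin n)
  neighbours v = filter (λ u → adj G v u Bool.≟ true) (allFin n)

  ∈-neighbours⁺ : ∀ {v u} → Adj G v u → u ∈ neighbours v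
  ∈-neighbours⁺ {v} {u} a = ∈-filter⁺ (λ u → adj G v u Bool.≟ true) (∈-allFin u) (Equivalence.to T-≡ a)

  ∈-neighbours⁻ : ∀ {v u} → u ∈ neighbours v → Adj G v u
  ∈-neighbours⁻ {v} u∈ =
    Equivalence.from T-≡ (proj₂ (∈-filter⁻ (λ u → adj G v u Bool.≟ true) {xs = allFin n} u∈))

  unique-neighbours : ∀ v → Unique (neighbours v)
  unique-neighbours v = Unique.filter⁺ (λ u → adj G v u Bool.≟ true) (Unique.allFin⁺ n)

  adj-irrefl : ∀ {v} → ¬ Adj G v v
  adj-irrefl {v} = subst T (Graph.irrefl G v)

  two-neighbours : ∀ {ks} (cyc : CycleAvoiding G N ks) p → let u = CycleAvoiding.c cyc p in
    ∃₂ λ x y → x ≢ y × Adj G u x × Adj G u y × x ∉ ks × y ∉ ks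
  two-neighbours cyc p with N | 3≤N | cyc
  ... | suc (suc (suc m)) | s≤s (s≤s (s≤s z≤n)) | cyc =
    -- Here `N = m + 3`, so `suc m + suc p` is `N − 1 + p`, the position of the predecessor of
    -- `c p`. It lies `N − 2` steps beyond the successor, and `0 < N − 2 < N`.
    c (suc m + suc p) , c (suc p) , c-distinct (suc m) (suc p) (s≤s z≤n) (s≤s (n≤1+n (suc m))) ,
    adj-sym (subst (Adj G (c (suc m + suc p)))
      (trans (cong c (cong (ℕ.suc ∘ suc) (+-suc m p))) (periodic p)) (step (suc m + suc p))) ,
    step p , avoids _ , avoids _
    where
    open CycleAvoiding cyc renaming (distinct to c-distinct)

  -- Otherwise delete all neighbours of u but one: u then lies on a cycle without two neighbours.
  minDegree : ∀ u → k + 2 ≤ degree G u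
  minDegree u = ≮⇒≥ λ deg< →
    let ks , sub , cyc , p , eq = cycle-through u others (Unique.drop⁺ 1 (unique-neighbours u)) u∉ (others≤ deg<)
        x , y , x≢y , ux , uy , x∉ , y∉ = two-neighbours cyc p
        nbr = λ {x} a → ∈-neighbours⁺ {u} {x} (subst (λ z → Adj G z x) eq a)
    in x≢y (same (neighbours u) (nbr ux) (nbr uy) (x∉ ∘ sub) (y∉ ∘ sub))
    where
    others = drop 1 (neighbours u)
    ∈-drop⁻ : ∀ {x : Fin n} xs → x ∈ drop 1 xs → x ∈ xs
    ∈-drop⁻ (_ ∷ _) x∈ = there x∈
    u∉ : u ∉ others
    u∉ u∈ = adj-irrefl (∈-neighbours⁻ (∈-drop⁻ (neighbours u) u∈))
    others≤ : degree G u < k + 2 → length others ≤ k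
    others≤ deg< = subst (_≤ k) (≡.sym (length-drop 1 (neighbours u)))
      (m≤n+o⇒m∸n≤o (degree G u) 1 (ℕ.s≤s⁻¹ (subst (degree G u <_) (+-comm k 2) deg<)))
    same : ∀ {x y : Fin n} xs → x ∈ xs → y ∈ xs → x ∉ drop 1 xs → y ∉ drop 1 xs → x ≡ y
    same (_ ∷ _) (here refl) (here refl) _ _ = refl
    same (_ ∷ _) (there x∈)  _           x∉ _ = contradiction x∈ x∉
    same (_ ∷ _) (here _)    (there y∈)  _ y∉ = contradiction y∈ y∉

  -- Induced paths with a prescribed end.

  -- The path grows at its head, so that `v` stays its last vertex.
  data InducedPath (v : Fin n) : List (Fin n) → Set where
    single : InducedPath v [ v ]
    cons   : ∀ {y z zs} → Adj G y z → All (λ u → ¬ Adj G y u) zs → All (y ≢_) (z ∷ zs) →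
             InducedPath v (z ∷ zs) → InducedPath v (y ∷ z ∷ zs)

  inducedPath-linked : ∀ {v ys} → InducedPath v ys → Linked (Adj G) ys
  inducedPath-linked single          = [-]
  inducedPath-linked (cons a _ _ ip) = a ∷ inducedPath-linked ip

  inducedPath-unique : ∀ {v ys} → InducedPath v ys → Unique ys
  inducedPath-unique single           = [] ∷ []
  inducedPath-unique (cons _ _ y∉ ip) = y∉ ∷ inducedPath-unique ip

  -- A detour in the making: in the constructions below `P` is an initial segment of `zs`. Of its
  -- length only a lower bound is kept, which is what `no-long-detour` asks for.
  Initial : Fin n → List (Fin n) → Fin n → ℕ → Set
  Initial z zs y d = ∃ λ P → d ≤ length P × Unique P × (∀ {x} → x ∈ P → x ∈ zs) ×
    Linked (Adj G) (z ∷ P ++ [ y ])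

  initial-[-] : ∀ {z u zs y} → Adj G z u → Adj G u y → Initial z (u ∷ zs) y 1
  initial-[-] zu uy = [ _ ] , s≤s z≤n , [] ∷ [] , (λ { (here refl) → here refl }) , zu ∷ uy ∷ [-]

  initial-∷ : ∀ {z u zs y d} → Adj G z u → All (u ≢_) zs → Initial u zs y d → Initial z (u ∷ zs) y (suc d)
  initial-∷ zu u∉ (P , d≤ , uP , sub , lP) =
    _ ∷ P , s≤s d≤ , All.tabulate (All.lookup u∉ ∘ sub) ∷ uP
    , (λ { (here refl) → here refl ; (there x∈) → there (sub x∈) }) , zu ∷ lP

  -- Follow the path from `z` as far as `u` and leave it there for `y`. The bound 1 suffices for
  -- replacing a single edge of the cycle.
  initial-to : ∀ {z zs u y} → Linked (Adj G) (z ∷ zs) → Unique zs → u ∈ zs → Adj G u y → Initial z zs y 1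
  initial-to (zu ∷ _) _ (here refl) uy = initial-[-] zu uy
  initial-to (zw ∷ l) (w∉ ∷ uq) (there u∈) uy with initial-∷ zw w∉ (initial-to l uq u∈ uy)
  ... | P , 2≤ , rest = P , ≤-trans (s≤s z≤n) 2≤ , rest

  -- With K ⊇ zs, the successor of z on a cycle avoiding K has no neighbour in zs: such a chord
  -- would close a detour through K around a single edge of the cycle.
  inducedPath-extend : ∀ {v z zs} → InducedPath v (z ∷ zs) → length zs ≤ k → ∃ λ y → InducedPath v (y ∷ z ∷ zs)
  inducedPath-extend {v} {z} {zs} ip zs≤k with inducedPath-unique ip
  ... | z∉ ∷ uzs =
    let ks , sub , cyc , p , eq = cycle-through z zs uzs (λ z∈ → All.lookup z∉ z∈ refl) zs≤k
    in next sub cyc p eq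
    where
    1<N : 1 < N
    1<N = ≤-trans (s≤s (s≤s z≤n)) 3≤N
    next : ∀ {ks} → (∀ {x} → x ∈ zs → x ∈ ks) → (cyc : CycleAvoiding G N ks) → ∀ p →
      CycleAvoiding.c cyc p ≡ z → ∃ λ y → InducedPath v (y ∷ z ∷ zs)
    next sub cyc p refl = c (suc p) , cons (adj-sym (step p)) no-chord fresh ip
      where
      open CycleAvoiding cyc renaming (distinct to c-distinct)
      fresh : All (c (suc p) ≢_) (c p ∷ zs)
      fresh = c-distinct 1 p (s≤s z≤n) 1<N ∷
        All.tabulate (λ x∈ eq → avoids (suc p) (sub (subst (_∈ zs) (≡.sym eq) x∈)))
      no-chord : All (λ u → ¬ Adj G (c (suc p)) u) zs
      no-chord = All.tabulate λ u∈ yu →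
        let P , 1≤P , uP , P⊆ , lP = initial-to (inducedPath-linked ip) uzs u∈ (adj-sym yu)
        in no-long-detour cyc p 1 P (s≤s z≤n) 1<N 1≤P uP (All.tabulate (sub ∘ P⊆)) lP

  inducedPath-exists : ∀ v m → m ≤ k → ∃₂ λ z zs → InducedPath v (z ∷ zs) × length zs ≡ m
  inducedPath-exists v zero    _   = v , [] , single , refl
  inducedPath-exists v (suc m) m<k with inducedPath-exists v m (<⇒≤ m<k)
  ... | z , zs , ip , len≡ with inducedPath-extend ip (subst (_≤ k) (≡.sym len≡) (<⇒≤ m<k))
  ...   | y , ip′ = y , z ∷ zs , ip′ , cong suc len≡

  -- Counting adjacencies between the path and the cycle.

  module _ (v : Fin n) {ks : List (Fin n)} (cyc : CycleAvoiding G N ks) where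
    open CycleAvoiding cyc renaming (distinct to c-distinct)

    -- The entry for [] counts v a second time, one step after the end of the path.
    hits : ℕ → List (Fin n) → ℕ
    hits p []       = χ (adj G v (c p))
    hits p (y ∷ ys) = χ (adj G y (c p)) + hits (suc p) ys

    -- Follow the path to the first later hit. At offset `suc d` this takes `d + 2` path vertices,
    -- one to spare, except at the extra entry for `v`, where it takes exactly `d + 1`. That spare
    -- vertex is why `v` can be counted twice.
    later-hit : ∀ {x y ys} p → Adj G x y → InducedPath v (y ∷ ys) → hits (suc p) ys ≢ 0 →
      ∃ λ d → Initial x (y ∷ ys) (c (suc d + p)) (suc d)
    later-hit {x} {y} p xy single ≢0 with adj G v (c (suc p)) in eq
    ... | true  = 0 , initial-[-] xy (Equivalence.from T-≡ eq)
    ... | false = contradiction refl ≢0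
    later-hit {x} {y} {y′ ∷ ys} p xy (cons yy′ _ y∉ ip) ≢0 with adj G y′ (c (suc p)) in eq
    ... | true  with initial-∷ xy y∉ (initial-[-] yy′ (Equivalence.from T-≡ eq))
    ...   | P , 2≤ , rest = 0 , P , ≤-trans (s≤s z≤n) 2≤ , rest
    later-hit {x} {y} {y′ ∷ ys} p xy (cons yy′ _ y∉ ip) ≢0 | false with later-hit (suc p) yy′ ip ≢0
    ...   | d , init = suc d , subst (λ q → Initial x (y ∷ y′ ∷ ys) (c q) (suc (suc d))) (cong suc (+-suc d p)) (initial-∷ xy y∉ init)

    -- Two hits would be joined through the path by a detour at least as long as their distance on
    -- the cycle.
    hits≤1 : ∀ {ys} → k < N → InducedPath v ys → (∀ {x} → x ∈ ys → x ∈ ks) → length ys ≤ k → ∀ p → hits p ys ≤ 1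
    hits≤1 {y ∷ ys} k<N ip sub len≤ p with adj G y (c p) in eq
    ... | true with hits (suc p) ys ≟ 0
    ...   | yes ≡0 = ≤-reflexive (cong suc ≡0)
    ...   | no ≢0 with later-hit p (adj-sym (Equivalence.from T-≡ eq)) ip ≢0
    ...     | d , P , d≤ , uP , P⊆ , lP = ⊥-elim
      (no-long-detour cyc p (suc d) P (s≤s z≤n)
        -- `suc d < N`, since `P` consists of at least `suc d` distinct vertices of a path with at
        -- most `k` vertices.
        (≤-<-trans d≤ (≤-<-trans (≤-trans (unique-⊆⇒length≤ uP P⊆) len≤) k<N)) d≤ uP (All.tabulate (sub ∘ P⊆)) lP)
    hits≤1 {y ∷ []} k<N single sub len≤ p | false with adj G v (c (suc p))
    ... | true  = ≤-refl
    ... | false = z≤n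
    hits≤1 {y ∷ z ∷ zs} k<N (cons _ _ _ ip) sub len≤ p | false =
      hits≤1 k<N ip (sub ∘ there) (<⇒≤ len≤) (suc p)

    hits-periodic : ∀ ys p → hits (N + p) ys ≡ hits p ys
    hits-periodic []       p = cong (χ ∘ adj G v) (periodic p)
    hits-periodic (y ∷ ys) p = cong₂ _+_ (cong (χ ∘ adj G y) (periodic p))
      (trans (cong (λ q → hits q ys) (≡.sym (+-suc N p))) (hits-periodic ys (suc p)))

    -- The number of neighbours of `u` on the cycle, as one period meets each vertex of the cycle
    -- once.
    cycleDegree : Fin n → ℕ
    cycleDegree u = ∑< N (λ p → χ (adj G u (c p)))

    totalDegree : List (Fin n) → ℕ
    totalDegree []       = cycleDegree v
    totalDegree (y ∷ ys) = cycleDegree y + totalDegree ys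

    -- Each entry of `hits p` reads the cycle at a fixed offset from `p`; by periodicity the offset
    -- does not affect a sum over one period.
    ∑hits : ∀ ys → ∑< N (λ p → hits p ys) ≡ totalDegree ys
    ∑hits []       = refl
    ∑hits (y ∷ ys) = trans (∑<-+ N _ _) (cong (cycleDegree y ℕ.+_)
      (trans (∑<-shift N (λ p → hits p ys)
        (trans (cong (λ q → hits q ys) (≡.sym (+-identityʳ N))) (hits-periodic ys 0))) (∑hits ys)))

    χ≤1 : ∀ b → χ b ≤ 1
    χ≤1 true  = ≤-refl
    χ≤1 false = z≤n

    cycleDegree≤N : ∀ u → cycleDegree u ≤ N
    cycleDegree≤N u = ∑<-≤ N _ (λ p → χ≤1 _)

    length-filter-applyUpTo : ∀ (b : Fin n → Bool) (f : ℕ → Fin n) m →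
      length (filter (λ x → b x Bool.≟ true) (applyUpTo f m)) ≡ ∑< m (λ p → χ (b (f p)))
    length-filter-applyUpTo b f zero = refl
    length-filter-applyUpTo b f (suc m) with b (f 0)
    ... | true  = cong suc (length-filter-applyUpTo b (f ∘ suc) m)
    ... | false = length-filter-applyUpTo b (f ∘ suc) m

    -- By `covers`, a neighbour of `u` outside `ks` lies on the cycle, so only those in `ks` have to
    -- be listed in `es`.
    degree≤ : ∀ u (es : List (Fin n)) → (∀ {x} → x ∈ ks → Adj G u x → x ∈ es) →
      degree G u ≤ length es + cycleDegree u
    degree≤ u es ks-nbrs = begin
      degree G u                     ≤⟨ unique-⊆⇒length≤ (unique-neighbours u) (λ x∈ → split (∈-neighbours⁻ x∈)) ⟩
      length (es ++ onCycle)         ≡⟨ length-++ es ⟩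
      length es + length onCycle     ≡⟨ cong (length es ℕ.+_) (length-filter-applyUpTo (adj G u) c N) ⟩
      length es + cycleDegree u      ∎
      where
      open ≤-Reasoning
      onCycle = filter (λ x → adj G u x Bool.≟ true) (applyUpTo c N)
      split : ∀ {x} → Adj G u x → x ∈ es ++ onCycle
      split {x} ux with x ∈? ks
      ... | yes x∈ = ∈-++⁺ˡ (ks-nbrs x∈ ux)
      ... | no x∉ with covers x∉
      ...   | p , p<N , refl = ∈-++⁺ʳ es (∈-filter⁺ (λ x → adj G u x Bool.≟ true) (∈-applyUpTo⁺ c p<N) (Equivalence.to T-≡ ux))

    -- y precedes z on the path, and the last alternative holds of the vertices of the path before y.
    totalDegree-lower : ∀ {y z zs} → InducedPath v (z ∷ zs) → All (λ u → ¬ Adj G y u) zs →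
      (∀ {x} → x ∈ ks → x ≡ y ⊎ x ∈ z ∷ zs ⊎ All (λ u → ¬ Adj G x u) (z ∷ zs)) →
      2 * degree G v + k * length zs ≤ totalDegree (z ∷ zs) + 2
    totalDegree-lower {y} single _ loc = begin
      2 * degree G v + k * 0                  ≡⟨ cong (2 * degree G v ℕ.+_) (*-zeroʳ k) ⟩
      2 * degree G v + 0                      ≡⟨ +-identityʳ _ ⟩
      -- The only possible neighbour of `v` in `ks` is `y`; it is lost twice because `v` is counted
      -- twice.
      2 * degree G v                          ≤⟨ *-monoʳ-≤ 2 (degree≤ v [ y ] nbrs) ⟩
      2 * (1 + cycleDegree v)                 ≡⟨ solve 1 (λ a → con 2 :* (con 1 :+ a) := a :+ a :+ con 2) refl (cycleDegree v) ⟩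
      cycleDegree v + cycleDegree v + 2       ∎
      where
      open ≤-Reasoning
      open +-*-Solver
      nbrs : ∀ {x} → x ∈ ks → Adj G v x → x ∈ [ y ]
      nbrs x∈ vx with loc x∈
      ... | inj₁ refl               = here refl
      ... | inj₂ (inj₁ (here refl)) = ⊥-elim (adj-irrefl vx)
      ... | inj₂ (inj₂ (¬xv ∷ _))   = ⊥-elim (¬xv (adj-sym vx))
    totalDegree-lower {y} {z} {w ∷ ws} (cons zw z≁ z∉ ip) y≁ loc = begin
      2 * degree G v + k * suc (length ws)           ≡⟨ cong (2 * degree G v ℕ.+_) (*-suc k (length ws)) ⟩
      2 * degree G v + (k + k * length ws)           ≡⟨ solve 3 (λ a b c → a :+ (b :+ c) := b :+ (a :+ c)) refl (2 * degree G v) k (k * length ws) ⟩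
      k + (2 * degree G v + k * length ws)           ≤⟨ +-mono-≤ k≤ (totalDegree-lower ip z≁ loc′) ⟩
      cycleDegree z + (totalDegree (w ∷ ws) + 2)     ≡⟨ +-assoc (cycleDegree z) (totalDegree (w ∷ ws)) 2 ⟨
      cycleDegree z + totalDegree (w ∷ ws) + 2       ∎
      where
      open ≤-Reasoning
      open +-*-Solver
      nbrs : ∀ {x} → x ∈ ks → Adj G z x → x ∈ y ∷ w ∷ []
      nbrs x∈ zx with loc x∈
      ... | inj₁ refl                       = here refl
      ... | inj₂ (inj₁ (here refl))         = ⊥-elim (adj-irrefl zx)
      ... | inj₂ (inj₁ (there (here refl))) = there (here refl)
      ... | inj₂ (inj₁ (there (there x∈)))  = ⊥-elim (All.lookup z≁ x∈ zx)
      ... | inj₂ (inj₂ (¬xz ∷ _))           = ⊥-elim (¬xz (adj-sym zx))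
      -- An inner vertex of the path loses at most its two path neighbours from a degree of at least
      -- `k + 2`.
      k≤ : k ≤ cycleDegree z
      k≤ = +-cancelˡ-≤ 2 k _ (≤-trans (subst (_≤ degree G z) (+-comm k 2) (minDegree z)) (degree≤ z (y ∷ w ∷ []) nbrs))
      loc′ : ∀ {x} → x ∈ ks → x ≡ z ⊎ x ∈ w ∷ ws ⊎ All (λ u → ¬ Adj G x u) (w ∷ ws)
      loc′ x∈ with loc x∈
      ... | inj₁ refl               = inj₂ (inj₂ y≁)
      ... | inj₂ (inj₁ (here refl)) = inj₁ refl
      ... | inj₂ (inj₁ (there x∈′)) = inj₂ (inj₁ x∈′)
      ... | inj₂ (inj₂ (_ ∷ x≁))    = inj₂ (inj₂ x≁)

    totalDegree≤N : ∀ {ys} → k < N → InducedPath v ys → (∀ {x} → x ∈ ys → x ∈ ks) → length ys ≤ k →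
      totalDegree ys ≤ N
    totalDegree≤N {ys} k<N ip sub len≤ =
      subst (_≤ N) (∑hits ys) (∑<-≤ N (λ p → hits p ys) (hits≤1 k<N ip sub len≤))

  -- The bound for a single vertex.

  degree-bound : .{{NonZero k}} → ∀ v → 2 * degree G v + k * k ≤ n + 1
  degree-bound v with inducedPath-exists v (k ∸ 1) (m∸n≤m k 1)
  -- Here `k = 1`: only `v` is deleted, so all its neighbours lie on the cycle.
  ... | _ , [] , single , eq = begin
    2 * degree G v + k * k                 ≤⟨ +-monoˡ-≤ (k * k) (*-monoʳ-≤ 2 (degree≤ v cyc v [] nbrs)) ⟩
    2 * cycleDegree v cyc v + k * k        ≡⟨ cong₂ (λ a b → a + b * b) (cong (cycleDegree v cyc v ℕ.+_) (+-identityʳ _)) k≡1 ⟩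
    totalDegree v cyc [ v ] + 1            ≤⟨ +-monoˡ-≤ 1 (totalDegree≤N v cyc k<N single (λ x∈ → x∈) (≤-reflexive (≡.sym k≡1))) ⟩
    N + 1                                  ≤⟨ +-monoˡ-≤ 1 (m∸n≤m n k) ⟩
    n + 1                                  ∎
    where
    open ≤-Reasoning
    k≡1 : k ≡ 1
    k≡1 = trans (≡.sym (m+[n∸m]≡n (ℕ.>-nonZero⁻¹ k))) (cong suc (≡.sym eq))
    k<N : k < N
    k<N = ≤-trans (s≤s (≤-reflexive k≡1)) (≤-trans (s≤s (s≤s z≤n)) 3≤N)
    cyc = cycleAvoiding {[ v ]} ([] ∷ []) (≡.sym k≡1)
    nbrs : ∀ {x} → x ∈ [ v ] → Adj G v x → x ∈ []
    nbrs (here refl) a = ⊥-elim (adj-irrefl a)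
  ... | y , z ∷ zs , ip@(cons yz y≁ y∉ ip′) , eq = begin
    2 * degree G v + k * k                              ≡⟨ cong (λ l → 2 * degree G v + k * l) (≡.sym len≡) ⟩
    2 * degree G v + k * (2 + length zs)                ≡⟨ solve 3 (λ d k l → con 2 :* d :+ k :* (con 2 :+ l) := con 2 :* d :+ k :* l :+ con 2 :* k) refl (degree G v) k (length zs) ⟩
    2 * degree G v + k * length zs + 2 * k              ≤⟨ +-monoˡ-≤ (2 * k) (totalDegree-lower v cyc ip′ y≁ (λ { (here eq) → inj₁ eq ; (there x∈) → inj₂ (inj₁ x∈) })) ⟩
    -- Of the surplus `2 + 2 * k`, the part `k + 1` is covered by the first vertex `y`, and `k`
    -- turns `N` into `n`; 1 remains.
    totalDegree v cyc (z ∷ zs) + 2 + 2 * k              ≡⟨ solve 2 (λ t k → t :+ con 2 :+ con 2 :* k := k :+ con 1 :+ t :+ k :+ con 1) refl (totalDegree v cyc (z ∷ zs)) k ⟩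
    k + 1 + totalDegree v cyc (z ∷ zs) + k + 1          ≤⟨ +-monoˡ-≤ 1 (+-monoˡ-≤ k (+-monoˡ-≤ (totalDegree v cyc (z ∷ zs)) k+1≤)) ⟩
    totalDegree v cyc (y ∷ z ∷ zs) + k + 1              ≤⟨ +-monoˡ-≤ 1 (+-monoˡ-≤ k (totalDegree≤N v cyc k<N ip (λ x∈ → x∈) (≤-reflexive len≡))) ⟩
    N + k + 1                                           ≡⟨ cong (ℕ._+ 1) (m∸n+n≡m k≤n) ⟩
    n + 1                                               ∎
    where
    open ≤-Reasoning
    open +-*-Solver
    len≡ : 2 + length zs ≡ k
    len≡ = trans (cong suc eq) (m+[n∸m]≡n (ℕ.>-nonZero⁻¹ k))
    cyc = cycleAvoiding (inducedPath-unique ip) len≡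
    nbrs : ∀ {x} → x ∈ y ∷ z ∷ zs → Adj G y x → x ∈ [ z ]
    nbrs (here refl)         a = ⊥-elim (adj-irrefl a)
    nbrs (there (here refl)) a = here refl
    nbrs (there (there x∈))  a = ⊥-elim (All.lookup y≁ x∈ a)
    -- As an end of the path, `y` loses only the one neighbour `z`.
    k+1≤ : k + 1 ≤ cycleDegree v cyc y
    k+1≤ = +-cancelˡ-≤ 1 (k + 1) _ (≤-trans (≤-reflexive (≡.sym (+-suc k 1))) (≤-trans (minDegree y) (degree≤ v cyc y [ z ] nbrs)))
    k<N : k < N
    k<N = ≤-trans (≤-reflexive (+-comm 1 k)) (≤-trans k+1≤ (cycleDegree≤N v cyc y))

-- Rational form and maximum degree.

-- On unnormalised fractions the comparison is a cross-multiplied inequality of integers, which is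
-- `h` with `s` subtracted from both sides.
halve-≤ : ∀ d s m → 2 * d + s ≤ m + 1 → ℚ._≤_ (+ d / 1) ((+ m - + s ℤ.+ + 1) / 2)
halve-≤ d s m h = ℚ.toℚᵘ-cancel-≤ (begin
  ℚ.toℚᵘ (+ d / 1)                          ≃⟨ ℚ.toℚᵘ-fromℚᵘ (ℚᵘ.mkℚᵘ (+ d) 0) ⟩
  ℚᵘ.mkℚᵘ (+ d) 0                           ≤⟨ ℚᵘ.*≤* numerators ⟩
  ℚᵘ.mkℚᵘ (+ m - + s ℤ.+ + 1) 1             ≃⟨ ℚ.toℚᵘ-fromℚᵘ (ℚᵘ.mkℚᵘ (+ m - + s ℤ.+ + 1) 1) ⟨
  ℚ.toℚᵘ ((+ m - + s ℤ.+ + 1) / 2)          ∎)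
  where
  open ℚᵘ.≤-Reasoning
  lhs : (x y : ℤ) → + 2 ℤ.* x ℤ.+ y - y ≡ x ℤ.* + 2
  lhs = solve-∀
  rhs : (x y : ℤ) → x ℤ.+ + 1 - y ≡ (x - y ℤ.+ + 1) ℤ.* + 1
  rhs = solve-∀
  numerators : + d ℤ.* + 2 ℤ.≤ (+ m - + s ℤ.+ + 1) ℤ.* + 1
  numerators = subst₂ ℤ._≤_
    (trans (cong (λ e → e ℤ.+ + s - + s) (ℤ.pos-* 2 d)) (lhs (+ d) (+ s)))
    (rhs (+ m) (+ s))
    (ℤ.+-monoˡ-≤ (ℤ.- + s) (ℤ.+≤+ h))

theorem1p2 : (n k : ℕ) → .{{_ : NonZero n}} → .{{_ : NonZero k}} → k ≤ n →
    (G : Graph n) → InΓ n k G →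
    ℚ._≤_ (+ maxDegree G / 1) ((+ n - + (k * k) Data.Integer.+ + 1) / 2)
theorem1p2 (suc m) k k≤n G inΓ = halve-≤ (maxDegree G) (k * k) (suc m)
  (foldr-preservesᵇ {P = Bounded} {f = _⊔_} (λ {a b} → ⊔-closed {a} {b})
    -- The fold for the maximum starts at 0, where the bound reads `k * k ≤ suc m + 1`; it follows
    -- from the bound at the vertex `zero`.
    (≤-trans (m≤n+m (k * k) (2 * degree G zero)) (degree-bound zero))
    (All.map⁺ {f = degree G} (All.tabulate {xs = allFin (suc m)} λ {v} _ → degree-bound v)))
  where
  open InΓ-Properties k≤n G inΓ
  Bounded : ℕ → Set
  Bounded d = 2 * d + k * k ≤ suc m + 1
  ⊔-closed : ∀ {a b} → Bounded a → Bounded b → Bounded (a ⊔ b)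
  ⊔-closed {a} {b} ha hb with ⊔-sel a b
  ... | inj₁ eq = subst Bounded (≡.sym eq) ha
  ... | inj₂ eq = subst Bounded (≡.sym eq) hb
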